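{- Let $G=(V,E)$ be a graph and let $v\in V$ be a vertex that is not a pendant vertex. Then $$\gamma_{sp}(G\odot v)\leq \gamma_{sp}(G)+\left\lfloor \frac{\deg(v)}{2}\right\rfloor-1.$$
   Context: Graphs are simple, without loops and directed edges. $N(v)=\{u\in V : uv\in E\}$ denotes the open neighbourhood of $v$, and $\deg(v)=|N(v)|$ is the degree of $v$ in $G$. A pendant vertex is a vertex of degree 1. For $S\subseteq V$ write $\overline{S}=V\setminus S$. A set $S\subseteq V$ is dominating if every vertex of $\overline{S}$ is adjacent to at least one vertex of $S$. A dominating set $S$ is a super dominating set of $G$ if for every $u\in\overline{S}$ there exists $w\in S$ with $N(w)\cap\overline{S}=\{u\}$. The super domination number $\gamma_{sp}(G)$ is the cardinality of a smallest super dominating set of $G$. For $v\in V$, $G\odot v$ is the graph obtained from $G$ by the removal of all edges between any pair of neighbours of $v$ (the vertex set is unchanged).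
   Formalization: The vertex v is also assumed not to be isolated (so deg(v) ≥ 2): for deg(v) = 0 the graph is unchanged and the bound would read γ_sp(G) ≤ γ_sp(G) − 1, which is false, e.g. for the one-vertex graph. -}

module Defs where

open import Data.Fin using (Fin)
open import Data.Fin.Properties using (all?; any?)
open import Data.Fin.Subset using (Subset; _∈_; _∩_; ∁; ⁅_⁆; ∣_∣; ⊤)
open import Data.Fin.Subset.Properties using (_∈?_; anySubset?; ∈⊤; x∈p⇒x∉∁p)
open import Data.Bool.Properties using () renaming (_≟_ to _≟ᵇ_)
open import Data.Nat using (ℕ; _≤_; _<_; _<?_)
open import Data.Nat.Induction using (<-wellFounded)
open import Data.Nat.Properties using (≮⇒≥)
open import Data.Product using (∃; _×_; _,_; proj₁)
open import Data.Vec using (tabulate)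
open import Data.Vec.Properties using (≡-dec)
open import Induction.WellFounded using (Acc; acc)
open import Level using (0ℓ)
open import Relation.Binary.Core using (Rel)
open import Relation.Binary.Definitions using (Decidable; Symmetric; Irreflexive)
open import Relation.Binary.PropositionalEquality using (_≡_)
open import Relation.Nullary using (¬_; Dec; yes; no; does; contradiction)
open import Relation.Nullary.Decidable using (_×-dec_; _→-dec_; ¬?)

record Graph (n : ℕ) : Set₁ where
  field
    Adj    : Rel (Fin n) 0ℓ
    adj?   : Decidable Adj
    sym    : Symmetric Adj
    irrefl : Irreflexive _≡_ Adj

open Graph public

N : ∀ {n} → Graph n → Fin n → Subset n
N G v = tabulate (λ u → does (adj? G v u))

deg : ∀ {n} → Graph n → Fin n → ℕ
deg G v = ∣ N G v ∣

Pendant : ∀ {n} → Graph n → Fin n → Set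
Pendant G v = deg G v ≡ 1

Dominating : ∀ {n} → Graph n → Subset n → Set
Dominating G S = ∀ u → u ∈ ∁ S → ∃ λ w → w ∈ S × Adj G u w

SuperDominating : ∀ {n} → Graph n → Subset n → Set
SuperDominating G S =
  Dominating G S ×
  (∀ u → u ∈ ∁ S → ∃ λ w → w ∈ S × N G w ∩ ∁ S ≡ ⁅ u ⁆)

infixl 7 _⊙_

_⊙_ : ∀ {n} → Graph n → Fin n → Graph n
G ⊙ v = record
  { Adj    = λ x y → Adj G x y × ¬ (Adj G v x × Adj G v y)
  ; adj?   = λ x y → adj? G x y ×-dec ¬? (adj? G v x ×-dec adj? G v y)
  ; sym    = λ (xy , ¬both) → sym G xy , λ (vy , vx) → ¬both (vx , vy)
  ; irrefl = λ x≡y (xy , _) → irrefl G x≡y xy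
  }

superDominating? : ∀ {n} (G : Graph n) (S : Subset n) → Dec (SuperDominating G S)
superDominating? G S =
  all? (λ u → (u ∈? ∁ S) →-dec any? (λ w → (w ∈? S) ×-dec adj? G u w))
  ×-dec
  all? (λ u → (u ∈? ∁ S) →-dec
    any? (λ w → (w ∈? S) ×-dec ≡-dec _≟ᵇ_ (N G w ∩ ∁ S) ⁅ u ⁆))

superDominating-⊤ : ∀ {n} (G : Graph n) → SuperDominating G ⊤
superDominating-⊤ G =
  (λ u u∈∁⊤ → contradiction u∈∁⊤ (x∈p⇒x∉∁p ∈⊤)) ,
  (λ u u∈∁⊤ → contradiction u∈∁⊤ (x∈p⇒x∉∁p ∈⊤))

Smallest : ∀ {n} → (Subset n → Set) → Subset n → Set
Smallest P S = P S × (∀ T → P T → ∣ S ∣ ≤ ∣ T ∣)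

smallest : ∀ {n} {P : Subset n → Set} → (∀ S → Dec (P S)) →
           ∃ P → ∃ (Smallest P)
smallest {P = P} P? (S₀ , PS₀) = go S₀ PS₀ (<-wellFounded ∣ S₀ ∣)
  where
  go : ∀ S → P S → Acc _<_ ∣ S ∣ → ∃ (Smallest P)
  go S PS (acc rs) with anySubset? (λ T → P? T ×-dec (∣ T ∣ <? ∣ S ∣))
  ... | yes (T , PT , T<S) = go T PT (rs T<S)
  ... | no  none           = S , PS , λ T PT → ≮⇒≥ (λ T<S → none (T , PT , T<S))

smallestSuperDominating : ∀ {n} (G : Graph n) → ∃ (Smallest (SuperDominating G))
smallestSuperDominating G = smallest (superDominating? G) (⊤ , superDominating-⊤ G)

γsp : ∀ {n} → Graph n → ℕ
γsp G = ∣ proj₁ (smallestSuperDominating G) ∣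

{-# OPTIONS --safe #-}
-- Let T be the complement of a minimum super dominating set of G: every u ∈ T
-- has a private neighbour, a vertex outside T whose only neighbour in T is u.
-- Call u ∈ T bad if all its private neighbours lose their edge to u in G ⊙ v,
-- i.e. u and they lie in N(v).  Deleting the set B of bad vertices from T leaves
-- a set in which private neighbours survive in G ⊙ v, and 2 |B| ≤ deg v because
-- distinct vertices have distinct private neighbours.  If this costs one vertex
-- too many, then N(v) ∩ T ⊆ B or every vertex of N(v) ∖ T is a private neighbour
-- of a bad vertex.  With u₀ bad and w₀ its private neighbour, in the first case
-- u₀ can be put back, with private neighbour v; in the second case v can be
-- added, with private neighbour w₀.
module Submission where

open import Defs
open import Data.Fin using (Fin; suc)
open import Data.Fin.Properties using (any?; all?; suc-injective) renaming (_≟_ to _≟ᶠ_)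
open import Data.Fin.Subset
  using (Subset; _∈_; _∉_; _∩_; _∪_; _-_; ∁; ⁅_⁆; ∣_∣; inside; outside)
open import Data.Fin.Subset.Properties
open import Data.Nat using (ℕ; suc; _+_; _∸_; _≤_; z≤n; s≤s; ⌊_/2⌋)
open import Data.Nat.Properties
  using (≤-trans; ≤∧≢⇒<; n≢0⇒n>0; +-mono-≤; +-monoˡ-≤; +-monoʳ-≤; +-cancelʳ-≤; ∸-monoˡ-≤;
         +-comm; +-assoc; +-suc; m+[n∸m]≡n; m≤o∸n⇒m+n≤o; ⌊n/2⌋-mono; n≡⌊n+n/2⌋;
         module ≤-Reasoning)
open import Data.Product using (∃; _×_; _,_; proj₁; proj₂)
open import Data.Sum using (inj₁; inj₂)
open import Data.Vec using ([]; _∷_; here; there; tabulate)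
open import Data.Vec.Properties using (lookup∘tabulate; lookup⇒[]=; []=⇒lookup)
open import Function using (_∘_)
open import Relation.Binary.PropositionalEquality
  using (_≡_; _≢_; refl; cong; subst; trans) renaming (sym to ≡-sym)
open import Relation.Nullary using (¬_; Dec; yes; no; does; contradiction)
open import Relation.Nullary.Decidable
  using (_×-dec_; _→-dec_; ¬?; dec-true; decidable-stable)
open import Relation.Unary using (Decidable)

-- Subsets cut out by decidable predicates, and counting

module _ {n} {P : Fin n → Set} (P? : Decidable P) where

  ∈-tabulate⁺ : ∀ {x} → P x → x ∈ tabulate (does ∘ P?)
  ∈-tabulate⁺ {x} Px =
    lookup⇒[]= x _ (trans (lookup∘tabulate (does ∘ P?) x) (dec-true (P? x) Px))

  ∈-tabulate⁻ : ∀ {x} → x ∈ tabulate (does ∘ P?) → P x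
  ∈-tabulate⁻ {x} x∈
    with P? x | trans (≡-sym (lookup∘tabulate (does ∘ P?) x)) ([]=⇒lookup x∈)
  ... | yes Px | _  = Px
  ... | no _   | ()

∣p∩q∣+∣p∩∁q∣≡∣p∣ : ∀ {n} (p q : Subset n) → ∣ p ∩ q ∣ + ∣ p ∩ ∁ q ∣ ≡ ∣ p ∣
∣p∩q∣+∣p∩∁q∣≡∣p∣ []            []            = refl
∣p∩q∣+∣p∩∁q∣≡∣p∣ (outside ∷ p) (_       ∷ q) = ∣p∩q∣+∣p∩∁q∣≡∣p∣ p q
∣p∩q∣+∣p∩∁q∣≡∣p∣ (inside  ∷ p) (inside  ∷ q) = cong suc (∣p∩q∣+∣p∩∁q∣≡∣p∣ p q)
∣p∩q∣+∣p∩∁q∣≡∣p∣ (inside  ∷ p) (outside ∷ q) =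
  trans (+-suc ∣ p ∩ q ∣ _) (cong suc (∣p∩q∣+∣p∩∁q∣≡∣p∣ p q))

-- Induction on `p`: the partner of the head is deleted from `q`, and injectivity keeps every later
-- partner away from it. `R` is a relation, so that a partner may depend on the proof of membership.
∣p∣≤∣q∣-injective : ∀ {m n} (p : Subset m) (q : Subset n) (R : Fin m → Fin n → Set) →
  (∀ {x} → x ∈ p → ∃ λ y → y ∈ q × R x y) →
  (∀ {x x′ y} → R x y → R x′ y → x ≡ x′) →
  ∣ p ∣ ≤ ∣ q ∣
∣p∣≤∣q∣-injective []            q R total inj = z≤n
∣p∣≤∣q∣-injective (outside ∷ p) q R total inj =
  ∣p∣≤∣q∣-injective p q (R ∘ suc) (total ∘ there) (λ r r′ → suc-injective (inj r r′))
∣p∣≤∣q∣-injective (inside ∷ p) q R total inj with total here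
... | y , y∈q , R0y = ≤-trans
  (s≤s (∣p∣≤∣q∣-injective p (q - y) (R ∘ suc) total′ (λ r r′ → suc-injective (inj r r′))))
  (x∈p⇒∣p-x∣<∣p∣ y∈q)
  where
  total′ : ∀ {x} → x ∈ p → ∃ λ y′ → y′ ∈ q - y × R (suc x) y′
  total′ x∈p with total (there x∈p)
  ... | y′ , y′∈q , Rxy′ = y′ , x∈p∧x≢y⇒x∈p-y y′∈q y′≢y , Rxy′
    where
    y′≢y : y′ ≢ y
    y′≢y refl with inj R0y Rxy′
    ... | ()

m+m≤n⇒m≤⌊n/2⌋ : ∀ {m n} → m + m ≤ n → m ≤ ⌊ n /2⌋
m+m≤n⇒m≤⌊n/2⌋ {m} {n} 2m≤n = subst (_≤ ⌊ n /2⌋) (≡-sym (n≡⌊n+n/2⌋ m)) (⌊n/2⌋-mono 2m≤n)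

-- Complements of super dominating sets

module _ {n} (G : Graph n) where

  ∈N⁺ : ∀ {v u} → Adj G v u → u ∈ N G v
  ∈N⁺ {v} = ∈-tabulate⁺ (adj? G v)

  ∈N⁻ : ∀ {v u} → u ∈ N G v → Adj G v u
  ∈N⁻ {v} = ∈-tabulate⁻ (adj? G v)

  PrivateNeighbour : Subset n → Fin n → Fin n → Set
  PrivateNeighbour T u w = w ∉ T × Adj G w u × (∀ x → x ∈ T → Adj G w x → x ≡ u)

  privateNeighbour? : ∀ T u w → Dec (PrivateNeighbour T u w)
  privateNeighbour? T u w =
    ¬? (w ∈? T) ×-dec adj? G w u ×-dec
    all? (λ x → (x ∈? T) →-dec (adj? G w x →-dec (x ≟ᶠ u)))

  PrivatelyDominated : Subset n → Set
  PrivatelyDominated T = ∀ u → u ∈ T → ∃ (PrivateNeighbour T u)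

  superDominating⇒privatelyDominated-∁ : ∀ {S} → SuperDominating G S → PrivatelyDominated (∁ S)
  superDominating⇒privatelyDominated-∁ {S} (_ , private-nb) u u∈∁S with private-nb u u∈∁S
  ... | w , w∈S , N∩∁S≡⁅u⁆ =
    w , x∈p⇒x∉∁p w∈S ,
    ∈N⁻ (proj₁ (x∈p∩q⁻ (N G w) (∁ S) (subst (u ∈_) (≡-sym N∩∁S≡⁅u⁆) (x∈⁅x⁆ u)))) ,
    λ x x∈∁S wx → x∈⁅y⁆⇒x≡y u (subst (x ∈_) N∩∁S≡⁅u⁆ (x∈p∩q⁺ (∈N⁺ wx , x∈∁S)))

  -- The private neighbour of `u` is the witness for both clauses.
  privatelyDominated⇒superDominating-∁ : ∀ {T} → PrivatelyDominated T → SuperDominating G (∁ T)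
  privatelyDominated⇒superDominating-∁ {T} priv = dominating , private-nb
    where
    ∁∁⁻ : ∀ {x} → x ∈ ∁ (∁ T) → x ∈ T
    ∁∁⁻ x∈ = x∉∁p⇒x∈p (x∈∁p⇒x∉p x∈)

    dominating : Dominating G (∁ T)
    dominating u u∈ with priv u (∁∁⁻ u∈)
    ... | w , w∉T , wu , _ = w , x∉p⇒x∈∁p w∉T , sym G wu

    private-nb : ∀ u → u ∈ ∁ (∁ T) → ∃ λ w → w ∈ ∁ T × N G w ∩ ∁ (∁ T) ≡ ⁅ u ⁆
    private-nb u u∈ with priv u (∁∁⁻ u∈)
    ... | w , w∉T , wu , unique = w , x∉p⇒x∈∁p w∉T , ⊆-antisym to from
      where
      to : ∀ {x} → x ∈ N G w ∩ ∁ (∁ T) → x ∈ ⁅ u ⁆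
      to {x} x∈ with x∈p∩q⁻ (N G w) (∁ (∁ T)) x∈
      ... | x∈N , x∈∁∁ with unique x (∁∁⁻ x∈∁∁) (∈N⁻ x∈N)
      ... | refl = x∈⁅x⁆ u

      from : ∀ {x} → x ∈ ⁅ u ⁆ → x ∈ N G w ∩ ∁ (∁ T)
      from x∈ with x∈⁅y⁆⇒x≡y u x∈
      ... | refl = x∈p∩q⁺ (∈N⁺ wu , u∈)

  γsp+∣T∣≤n : ∀ {T} → PrivatelyDominated T → γsp G + ∣ T ∣ ≤ n
  γsp+∣T∣≤n {T} priv = m≤o∸n⇒m+n≤o (γsp G) (∣p∣≤n T)
    (subst (γsp G ≤_) (∣∁p∣≡n∸∣p∣ T)
      (proj₂ (proj₂ (smallestSuperDominating G)) (∁ T)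
        (privatelyDominated⇒superDominating-∁ priv)))

  γsp+∣T∣≡n : ∃ λ T → PrivatelyDominated T × γsp G + ∣ T ∣ ≡ n
  γsp+∣T∣≡n =
    ∁ S , superDominating⇒privatelyDominated-∁ (proj₁ (proj₂ (smallestSuperDominating G))) ,
    trans (cong (∣ S ∣ +_) (∣∁p∣≡n∸∣p∣ S)) (m+[n∸m]≡n (∣p∣≤n S))
    where
    S : Subset n
    S = proj₁ (smallestSuperDominating G)

-- Bad vertices and their number

module _ {n} (G : Graph n) (v : Fin n) (2≤deg : 2 ≤ deg G v)
         (T : Subset n) (priv : PrivatelyDominated G T) where

  Survives : Fin n → Fin n → Set
  Survives u w = PrivateNeighbour G T u w × ¬ (Adj G v w × Adj G v u)

  survives? : ∀ u w → Dec (Survives u w)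
  survives? u w = privateNeighbour? G T u w ×-dec ¬? (adj? G v w ×-dec adj? G v u)

  Bad : Fin n → Set
  Bad u = u ∈ T × ¬ ∃ (Survives u)

  bad? : Decidable Bad
  bad? u = (u ∈? T) ×-dec ¬? (any? (survives? u))

  B T∖B : Subset n
  B   = tabulate (does ∘ bad?)
  T∖B = T ∩ ∁ B

  bad⇒adjacent : ∀ {u w} → Bad u → PrivateNeighbour G T u w → Adj G v w × Adj G v u
  bad⇒adjacent {u} {w} (_ , ¬survives) pn =
    decidable-stable (adj? G v w ×-dec adj? G v u) (λ ¬both → ¬survives (w , pn , ¬both))

  ∈T∖B⁻ : ∀ {u} → u ∈ T∖B → u ∈ T × ¬ Bad u
  ∈T∖B⁻ u∈ with x∈p∩q⁻ T (∁ B) u∈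
  ... | u∈T , u∈∁B = u∈T , λ bad → x∈∁p⇒x∉p u∈∁B (∈-tabulate⁺ bad? bad)

  ∈T∖B⇒survives : ∀ {u} → u ∈ T∖B → ∃ (Survives u)
  ∈T∖B⇒survives {u} u∈ with ∈T∖B⁻ u∈
  ... | u∈T , ¬bad = decidable-stable (any? (survives? u)) (λ ¬s → ¬bad (u∈T , ¬s))

  -- Membership in `T` is part of the relation because the uniqueness clause for `w` speaks only of
  -- vertices of `T`.
  private-injective : ∀ {u u′ w} → u ∈ T × PrivateNeighbour G T u w →
    u′ ∈ T × PrivateNeighbour G T u′ w → u ≡ u′
  private-injective {u} (u∈T , _ , wu , _) (_ , _ , _ , unique) = unique u u∈T wu

  B⊆N∩T : ∀ {u} → u ∈ B → u ∈ N G v ∩ T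
  B⊆N∩T {u} u∈B with ∈-tabulate⁻ bad? u∈B
  ... | bad@(u∈T , _) =
    x∈p∩q⁺ (∈N⁺ G (proj₂ (bad⇒adjacent bad (proj₂ (priv u u∈T)))) , u∈T)

  privateNeighbour-N∖T : ∀ {u} → u ∈ B →
    ∃ λ w → w ∈ N G v ∩ ∁ T × u ∈ T × PrivateNeighbour G T u w
  privateNeighbour-N∖T {u} u∈B with ∈-tabulate⁻ bad? u∈B
  ... | bad@(u∈T , _) with priv u u∈T
  ... | w , pn@(w∉T , _) =
    w , x∈p∩q⁺ (∈N⁺ G (proj₁ (bad⇒adjacent bad pn)) , x∉p⇒x∈∁p w∉T) , u∈T , pn

  ∣B∣≤∣N∩T∣ : ∣ B ∣ ≤ ∣ N G v ∩ T ∣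
  ∣B∣≤∣N∩T∣ = p⊆q⇒∣p∣≤∣q∣ B⊆N∩T

  ∣B∣≤∣N∖T∣ : ∣ B ∣ ≤ ∣ N G v ∩ ∁ T ∣
  ∣B∣≤∣N∖T∣ = ∣p∣≤∣q∣-injective B _ (λ u w → u ∈ T × PrivateNeighbour G T u w)
    privateNeighbour-N∖T private-injective

  -- The two sets partition the neighbourhood of `v`.
  half-bound : ∀ {m} → m ≤ ∣ N G v ∩ T ∣ → m ≤ ∣ N G v ∩ ∁ T ∣ → m ≤ ⌊ deg G v /2⌋
  half-bound {m} m≤∩ m≤∖ = m+m≤n⇒m≤⌊n/2⌋
    (subst (m + m ≤_) (∣p∩q∣+∣p∩∁q∣≡∣p∣ (N G v) T) (+-mono-≤ m≤∩ m≤∖))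

  ∣T∣≤∣T∖B∣+∣B∣ : ∣ T ∣ ≤ ∣ T∖B ∣ + ∣ B ∣
  ∣T∣≤∣T∖B∣+∣B∣ = begin
    ∣ T ∣                  ≡⟨ ∣p∩q∣+∣p∩∁q∣≡∣p∣ T B ⟨
    ∣ T ∩ B ∣ + ∣ T∖B ∣    ≤⟨ +-monoˡ-≤ ∣ T∖B ∣ (∣p∩q∣≤∣q∣ T B) ⟩
    ∣ B ∣ + ∣ T∖B ∣        ≡⟨ +-comm ∣ B ∣ ∣ T∖B ∣ ⟩
    ∣ T∖B ∣ + ∣ B ∣        ∎
    where open ≤-Reasoning

  -- Large complements in `G ⊙ v`

  -- The theorem in terms of complements; the `suc` becomes its `∸ 1`.
  Replacement : Set
  Replacement = ∃ λ T′ → PrivatelyDominated (G ⊙ v) T′ × suc ∣ T ∣ ≤ ∣ T′ ∣ + ⌊ deg G v /2⌋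

  -- `T′` may leave `T`, as it does when `v` is added, as long as `w` has no neighbour among the new
  -- vertices.
  survives⇒private : ∀ {T′ u w} → Survives u w → w ∉ T′ →
    (∀ x → x ∈ T′ → Adj G w x → x ∈ T) → PrivateNeighbour (G ⊙ v) T′ u w
  survives⇒private ((_ , wu , unique) , ¬both) w∉T′ nb∈T =
    w∉T′ , (wu , ¬both) , λ x x∈T′ (wx , _) → unique x (nb∈T x x∈T′ wx) wx

  -- The slack in the bound on `B` pays for the `suc`.
  discard : suc ∣ B ∣ ≤ ⌊ deg G v /2⌋ → Replacement
  discard ∣B∣<h = T∖B , dominated , bound
    where
    dominated : PrivatelyDominated (G ⊙ v) T∖B
    dominated u u∈ with ∈T∖B⇒survives u∈
    ... | w , s@((w∉T , _) , _) = w ,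
      survives⇒private s (w∉T ∘ proj₁ ∘ ∈T∖B⁻) (λ x x∈ _ → proj₁ (∈T∖B⁻ x∈))

    open ≤-Reasoning
    bound : suc ∣ T ∣ ≤ ∣ T∖B ∣ + ⌊ deg G v /2⌋
    bound = begin
      suc ∣ T ∣                  ≤⟨ s≤s ∣T∣≤∣T∖B∣+∣B∣ ⟩
      suc (∣ T∖B ∣ + ∣ B ∣)      ≡⟨ +-suc ∣ T∖B ∣ ∣ B ∣ ⟨
      ∣ T∖B ∣ + suc ∣ B ∣        ≤⟨ +-monoʳ-≤ ∣ T∖B ∣ ∣B∣<h ⟩
      ∣ T∖B ∣ + ⌊ deg G v /2⌋    ∎

  module _ (a : Fin n) where

    ∈insert⁻ : ∀ {P : Fin n → Set} → P a → (∀ {x} → x ∈ T∖B → P x) →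
      ∀ {x} → x ∈ ⁅ a ⁆ ∪ T∖B → P x
    ∈insert⁻ Pa PT∖B x∈ with x∈p∪q⁻ ⁅ a ⁆ T∖B x∈
    ... | inj₂ x∈T∖B = PT∖B x∈T∖B
    ... | inj₁ x∈⁅a⁆ with x∈⁅y⁆⇒x≡y a x∈⁅a⁆
    ... | refl = Pa

    -- Here the new vertex `a` pays for the `suc`, so the plain bound on `B` suffices.
    insert : a ∉ T∖B → PrivatelyDominated (G ⊙ v) (⁅ a ⁆ ∪ T∖B) → Replacement
    insert a∉T∖B dominated = ⁅ a ⁆ ∪ T∖B , dominated , (begin
      suc ∣ T ∣                          ≤⟨ s≤s ∣T∣≤∣T∖B∣+∣B∣ ⟩
      suc ∣ T∖B ∣ + ∣ B ∣                ≤⟨ +-mono-≤ T∖B<T′ (half-bound ∣B∣≤∣N∩T∣ ∣B∣≤∣N∖T∣) ⟩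
      ∣ ⁅ a ⁆ ∪ T∖B ∣ + ⌊ deg G v /2⌋    ∎)
      where
      open ≤-Reasoning
      T∖B<T′ : suc ∣ T∖B ∣ ≤ ∣ ⁅ a ⁆ ∪ T∖B ∣
      T∖B<T′ = p⊂q⇒∣p∣<∣q∣
        ((λ x∈ → x∈p∪q⁺ (inj₂ x∈)) , a , x∈p∪q⁺ (inj₁ (x∈⁅x⁆ a)) , a∉T∖B)

  module _ (u₀ : Fin n) (u₀∈B : u₀ ∈ B) where

    bad₀ : Bad u₀
    bad₀ = ∈-tabulate⁻ bad? u₀∈B

    u₀∈T : u₀ ∈ T
    u₀∈T = proj₁ bad₀

    w₀ : Fin n
    w₀ = proj₁ (priv u₀ u₀∈T)

    pn₀ : PrivateNeighbour G T u₀ w₀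
    pn₀ = proj₂ (priv u₀ u₀∈T)

    vw₀ : Adj G v w₀
    vw₀ = proj₁ (bad⇒adjacent bad₀ pn₀)

    vu₀ : Adj G v u₀
    vu₀ = proj₂ (bad⇒adjacent bad₀ pn₀)

    ¬vv : ∀ {x} → x ≡ v → ¬ Adj G v x
    ¬vv x≡v = irrefl G (≡-sym x≡v)

    -- Otherwise w₀ would have the two neighbours u₀ and v in T.
    v∉T : v ∉ T
    v∉T v∈T = ¬vv (≡-sym (proj₂ (proj₂ pn₀) v v∈T (sym G vw₀))) vu₀

    insert-u₀ : (∀ {z} → z ∈ N G v ∩ T → z ∈ B) → Replacement
    insert-u₀ N∩T⊆B = insert u₀ (λ u₀∈ → proj₂ (∈T∖B⁻ u₀∈) bad₀) dominated
      where
      T′⊆T : ∀ {x} → x ∈ ⁅ u₀ ⁆ ∪ T∖B → x ∈ T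
      T′⊆T = ∈insert⁻ u₀ u₀∈T (proj₁ ∘ ∈T∖B⁻)

      dominated : PrivatelyDominated (G ⊙ v) (⁅ u₀ ⁆ ∪ T∖B)
      dominated u = ∈insert⁻ u₀ {P = λ u → ∃ (PrivateNeighbour (G ⊙ v) _ u)}
        -- The edge from `v` to `u₀` remains because `v` is not its own neighbour; every other
        -- neighbour of `v` in `T` is bad and has been deleted.
        (v , v∉T ∘ T′⊆T , (vu₀ , ¬vv refl ∘ proj₁) ,
          λ x x∈ (vx , _) → ∈insert⁻ u₀ {P = λ x → Adj G v x → x ≡ u₀} (λ _ → refl)
            (λ x∈T∖B vx → contradiction
              (∈-tabulate⁻ bad? (N∩T⊆B (x∈p∩q⁺ (∈N⁺ G vx , proj₁ (∈T∖B⁻ x∈T∖B)))))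
              (proj₂ (∈T∖B⁻ x∈T∖B))) x∈ vx)
        (λ u∈ → let w , s = ∈T∖B⇒survives u∈ in
          w , survives⇒private s (proj₁ (proj₁ s) ∘ T′⊆T) (λ x x∈ _ → T′⊆T x∈))

    insert-v : (∀ y → y ∈ N G v ∩ ∁ T → ∃ λ u → u ∈ B × PrivateNeighbour G T u y) → Replacement
    insert-v covered = insert v (v∉T ∘ proj₁ ∘ ∈T∖B⁻) dominated
      where
      w₀∉T′ : w₀ ∉ ⁅ v ⁆ ∪ T∖B
      w₀∉T′ w₀∈ = ∈insert⁻ v {P = λ x → x ≢ w₀} (λ v≡w₀ → ¬vv (≡-sym v≡w₀) vw₀)
        (λ x∈ x≡w₀ → proj₁ pn₀ (subst (_∈ T) x≡w₀ (proj₁ (∈T∖B⁻ x∈)))) w₀∈ refl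

      -- The only neighbour of `w₀` in `T` is `u₀`, which is bad and hence deleted.
      w₀-unique : ∀ x → x ∈ ⁅ v ⁆ ∪ T∖B → Adj (G ⊙ v) w₀ x → x ≡ v
      w₀-unique x = ∈insert⁻ v {P = λ x → Adj (G ⊙ v) w₀ x → x ≡ v} (λ _ → refl)
        λ x∈ (w₀x , _) → contradiction
          (subst Bad (≡-sym (proj₂ (proj₂ pn₀) _ (proj₁ (∈T∖B⁻ x∈)) w₀x)) bad₀)
          (proj₂ (∈T∖B⁻ x∈))

      still-private : ∀ {u} → u ∈ T∖B → ∃ (PrivateNeighbour (G ⊙ v) (⁅ v ⁆ ∪ T∖B) u)
      still-private {u} u∈ with ∈T∖B⁻ u∈ | ∈T∖B⇒survives u∈
      ... | u∈T , ¬bad | w , s@(pn@(w∉T , wu , unique) , _) =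
        w , survives⇒private s
          (λ w∈ → ∈insert⁻ v {P = _≢ w} v≢w
            (λ x∈ x≡w → w∉T (subst (_∈ T) x≡w (proj₁ (∈T∖B⁻ x∈)))) w∈ refl)
          (λ x → ∈insert⁻ v {P = λ x → Adj G w x → x ∈ T}
            (λ wv → contradiction (sym G wv) ¬vw) (λ x∈ _ → proj₁ (∈T∖B⁻ x∈)))
        where
        -- If `w` were `v`, its neighbour `u₀` in `T` would have to be `u`, which is not bad.
        v≢w : v ≢ w
        v≢w refl = ¬bad (subst Bad (unique u₀ u₀∈T vu₀) bad₀)

        -- A neighbour `w` of `v` would be private to some bad `u′`, forcing `u′` to equal `u`.
        ¬vw : ¬ Adj G v w
        ¬vw vw with covered w (x∈p∩q⁺ (∈N⁺ G vw , x∉p⇒x∈∁p w∉T))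
        ... | u′ , u′∈B , pn′ = ¬bad (subst Bad
          (private-injective (proj₁ bad′ , pn′) (u∈T , pn)) bad′)
          where bad′ = ∈-tabulate⁻ bad? u′∈B

      dominated : PrivatelyDominated (G ⊙ v) (⁅ v ⁆ ∪ T∖B)
      dominated u = ∈insert⁻ v {P = λ u → ∃ (PrivateNeighbour (G ⊙ v) _ u)}
        (w₀ , w₀∉T′ , (sym G vw₀ , ¬vv refl ∘ proj₂) , w₀-unique)
        still-private

  replacement : Replacement
  replacement with any? (_∈? B)
  -- With no bad vertex, the slack is just that half of a degree of at least 2 is at least 1.
  ... | no B-empty = discard
    (subst (λ k → suc k ≤ ⌊ deg G v /2⌋)
      (≡-sym (trans (cong ∣_∣ (Empty-unique B-empty)) (∣⊥∣≡0 n))) (⌊n/2⌋-mono 2≤deg))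
  ... | yes (u₀ , u₀∈B) with any? (λ z → (z ∈? (N G v ∩ T)) ×-dec ¬? (z ∈? B))
  ... | no N∩T⊆B = insert-u₀ u₀ u₀∈B
    (λ {z} z∈ → decidable-stable (z ∈? B) (λ z∉B → N∩T⊆B (z , z∈ , z∉B)))
  ... | yes (z , z∈ , z∉B)
    with any? (λ y → (y ∈? (N G v ∩ ∁ T)) ×-dec
                     ¬? (any? (λ u → (u ∈? B) ×-dec privateNeighbour? G T u y)))
  ... | no covered = insert-v u₀ u₀∈B
    (λ y y∈ → decidable-stable (any? (λ u → (u ∈? B) ×-dec privateNeighbour? G T u y))
      (λ ¬c → covered (y , y∈ , ¬c)))
  -- Both counts of `B` become strict: `z` is a neighbour of `v` in `T` outside `B`, and `y` is a
  -- neighbour outside `T` that is private to no bad vertex.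
  ... | yes (y , y∈ , uncovered) = discard (half-bound
    (p⊂q⇒∣p∣<∣q∣ (B⊆N∩T , z , z∈ , z∉B))
    (≤-trans (s≤s ∣B∣≤∣N∖T-y∣) (x∈p⇒∣p-x∣<∣p∣ y∈)))
    where
    ∣B∣≤∣N∖T-y∣ : ∣ B ∣ ≤ ∣ N G v ∩ ∁ T - y ∣
    ∣B∣≤∣N∖T-y∣ = ∣p∣≤∣q∣-injective B _ (λ u w → u ∈ T × PrivateNeighbour G T u w)
      (λ {u} u∈B → let w , w∈ , u∈T , pn = privateNeighbour-N∖T u∈B in
        w , x∈p∧x≢y⇒x∈p-y w∈
          (λ w≡y → uncovered (u , u∈B , subst (PrivateNeighbour G T u) w≡y pn)) , u∈T , pn)
      private-injective

theorem2p6 : ∀ {n : ℕ} (G : Graph n) (v : Fin n) →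
    ¬ Pendant G v → deg G v ≢ 0 →
    γsp (G ⊙ v) ≤ (γsp G + ⌊ deg G v /2⌋) ∸ 1
theorem2p6 {n} G v ¬pendant deg≢0 with γsp+∣T∣≡n G
-- A degree other than 0 and 1 is at least 2.
... | T , priv , γ+∣T∣≡n with replacement G v (≤∧≢⇒< (n≢0⇒n>0 deg≢0) (¬pendant ∘ ≡-sym)) T priv
-- The inequality is proved with a `suc` on the left, so the truncated subtraction loses nothing.
... | T′ , priv′ , ∣T∣<∣T′∣+h = ∸-monoˡ-≤ 1 (+-cancelʳ-≤ ∣ T′ ∣ _ _ (begin
  suc (γsp (G ⊙ v)) + ∣ T′ ∣               ≤⟨ s≤s (γsp+∣T∣≤n (G ⊙ v) priv′) ⟩
  suc n                                    ≡⟨ cong suc γ+∣T∣≡n ⟨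
  suc (γsp G + ∣ T ∣)                      ≡⟨ +-suc (γsp G) ∣ T ∣ ⟨
  γsp G + suc ∣ T ∣                        ≤⟨ +-monoʳ-≤ (γsp G) ∣T∣<∣T′∣+h ⟩
  γsp G + (∣ T′ ∣ + ⌊ deg G v /2⌋)         ≡⟨ cong (γsp G +_) (+-comm ∣ T′ ∣ _) ⟩
  γsp G + (⌊ deg G v /2⌋ + ∣ T′ ∣)         ≡⟨ +-assoc (γsp G) _ _ ⟨
  (γsp G + ⌊ deg G v /2⌋) + ∣ T′ ∣         ∎))
  where open ≤-Reasoning
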